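{- For all graphs $G$ and $H$, $$\operatorname{sbn}(G\,\square\, H)\geq \operatorname{sbn}(G)\operatorname{sbn}(H).$$
   Context: All graphs are simple, finite and undirected. A set $A\subseteq V(G)$ is connected in $G$ if the induced subgraph $G[A]$ is connected. A strict bramble in $G$ is a collection $\mathscr{S}$ of non-empty connected subsets of $V(G)$ that pairwise intersect. A hitting set for $\mathscr{S}$ is a set $S\subseteq V(G)$ that intersects every element of $\mathscr{S}$; the order of $\mathscr{S}$ is the minimum size of a hitting set for $\mathscr{S}$. The strict bramble number $\operatorname{sbn}(G)$ is the maximum order of a strict bramble in $G$. The Cartesian product $G\,\square\, H$ is the graph with vertex set $V(G)\times V(H)$, where $(g_1,h_1)(g_2,h_2)$ is an edge if and only if $g_1=g_2$ and $h_1h_2\in E(H)$; or $g_1g_2\in E(G)$ and $h_1=h_2$. -}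

module Defs where

open import Level using (0ℓ)
open import Data.Bool.Properties using () renaming (_≟_ to _≟ᵇ_)
open import Data.Empty using (⊥-elim)
open import Data.Fin using (Fin; remQuot)
open import Data.Fin.Properties using (all?; _≟_)
open import Data.Fin.Subset using (Subset; inside; outside; _∈_; _∩_; ∣_∣; Nonempty; ⊤)
open import Data.Fin.Subset.Properties
  using (_∈?_; nonempty?; anySubset?; ∣p∣≤n; ∣⊤∣≡n; ∈⊤; x∈p∩q⁺)
open import Data.List using (List; []; _∷_; _++_; map; filter; allFin)
open import Data.List.Membership.Propositional using (find; lose) renaming (_∈_ to _∈ₗ_)
open import Data.List.Membership.Propositional.Properties
  using (∈-++⁺ˡ; ∈-++⁺ʳ; ∈-map⁺; ∈-filter⁺; ∈-filter⁻; ∈-allFin)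
import Data.List.Membership.DecPropositional as DecMembership
import Data.List.Relation.Unary.All as All
open import Data.List.Relation.Unary.Any as Any using (here; there)
open import Data.Nat using (ℕ; zero; suc; _*_; _≤_; z≤n; s≤s)
open import Data.Nat.Properties using (≤-antisym; m≤n⇒m<n∨m≡n)
  renaming (_≟_ to _≟ⁿ_)
open import Data.Product using (∃; _×_; _,_; proj₁; proj₂)
open import Data.Sum using (_⊎_; inj₁; inj₂; [_,_]′) renaming (map to map⊎)
open import Data.Vec using ([]; _∷_)
open import Data.Vec.Properties using (≡-dec)
open import Function using (_∘_; _on_)
open import Relation.Binary using (Rel; Symmetric; Irreflexive; DecidableEquality)
  renaming (Decidable to Decidable₂)
open import Relation.Binary.Construct.Closure.ReflexiveTransitive using (Star; ε; _◅_; _◅◅_)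
open import Relation.Binary.PropositionalEquality using (_≡_; refl; sym)
open import Relation.Nullary using (Dec; yes; no)
open import Relation.Nullary.Decidable using (map′; _×-dec_; _⊎-dec_; _→-dec_)
open import Relation.Unary using (Pred; Decidable)

-- A finite simple graph, with its vertices numbered.  Decidability of
-- adjacency holds classically for every graph, so it is no restriction.
record Graph (n : ℕ) : Set₁ where
  field
    Adj    : Rel (Fin n) 0ℓ
    adj?   : Decidable₂ Adj
    symm   : Symmetric Adj
    irrefl : Irreflexive _≡_ Adj

InducedAdj : ∀ {n} → Graph n → Subset n → Rel (Fin n) 0ℓ
InducedAdj G A u v = u ∈ A × v ∈ A × Graph.Adj G u v

-- An inhabitant of Star (InducedAdj G A) u v is a walk from u to v in G[A].
-- The empty set satisfies this; StrictBramble excludes it separately.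
Connected : ∀ {n} → Graph n → Subset n → Set
Connected G A = ∀ {u v} → u ∈ A → v ∈ A → Star (InducedAdj G A) u v

-- A set of vertex sets, given by a list of its elements.  Everything below
-- depends only on membership, so order and repetition do not matter.
Collection : ℕ → Set
Collection n = List (Subset n)

record StrictBramble {n} (G : Graph n) (S : Collection n) : Set where
  field
    nonempty  : ∀ {A} → A ∈ₗ S → Nonempty A
    connected : ∀ {A} → A ∈ₗ S → Connected G A
    intersect : ∀ {A B} → A ∈ₗ S → B ∈ₗ S → Nonempty (A ∩ B)

HittingSet : ∀ {n} → Collection n → Subset n → Set
HittingSet S X = ∀ {A} → A ∈ₗ S → Nonempty (A ∩ X)

IsMinimum IsMaximum : Pred ℕ 0ℓ → Pred ℕ 0ℓ
IsMinimum P k = P k × (∀ {j} → P j → k ≤ j)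
IsMaximum P k = P k × (∀ {j} → P j → j ≤ k)

HittingSize : ∀ {n} → Collection n → Pred ℕ 0ℓ
HittingSize S k = ∃ λ X → HittingSet S X × ∣ X ∣ ≡ k

IsOrder : ∀ {n} → Collection n → Pred ℕ 0ℓ
IsOrder S = IsMinimum (HittingSize S)

StrictBrambleOrder : ∀ {n} → Graph n → Pred ℕ 0ℓ
StrictBrambleOrder G k = ∃ λ S → StrictBramble G S × IsOrder S k

IsSbn : ∀ {n} → Graph n → Pred ℕ 0ℓ
IsSbn G = IsMaximum (StrictBrambleOrder G)

-- remQuot n : Fin (m * n) → Fin m × Fin n is a bijection, so Fin (m * n)
-- serves as the vertex set V(G) × V(H).
infixr 7 _□_
_□_ : ∀ {m n} → Graph m → Graph n → Graph (m * n)
_□_ {m} {n} G H = record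
  { Adj    = PairAdj on remQuot n
  ; adj?   = λ x y → pairAdj? (remQuot n x) (remQuot n y)
  ; symm   = pairSym
  ; irrefl = λ { refl → [ H.irrefl refl ∘ proj₂ , G.irrefl refl ∘ proj₁ ]′ }
  }
  where
  module G = Graph G
  module H = Graph H

  PairAdj : Rel (Fin m × Fin n) 0ℓ
  PairAdj (g₁ , h₁) (g₂ , h₂) = (g₁ ≡ g₂ × H.Adj h₁ h₂) ⊎ (G.Adj g₁ g₂ × h₁ ≡ h₂)

  pairAdj? : Decidable₂ PairAdj
  pairAdj? (g₁ , h₁) (g₂ , h₂) =
    ((g₁ ≟ g₂) ×-dec H.adj? h₁ h₂) ⊎-dec (G.adj? g₁ g₂ ×-dec (h₁ ≟ h₂))

  pairSym : Symmetric (PairAdj on remQuot n)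
  pairSym = map⊎ (λ (p , q) → sym p , H.symm q) (λ (p , q) → G.symm p , sym q)

-- The rest shows constructively that the maximum defining sbn exists.

minimum : ∀ {P : Pred ℕ 0ℓ} → Decidable P → ∀ n → P n → ∃ (IsMinimum P)
minimum P? n pn with P? 0
... | yes p0 = 0 , p0 , λ _ → z≤n
minimum P? zero    pn | no ¬p0 = ⊥-elim (¬p0 pn)
minimum {P} P? (suc n) pn | no ¬p0 with minimum (P? ∘ suc) n pn
... | k , pk , least = suc k , pk , least′
  where
  least′ : ∀ {j} → P j → suc k ≤ j
  least′ {zero}  p0 = ⊥-elim (¬p0 p0)
  least′ {suc j} pj = s≤s (least pj)

maximum : ∀ {P : Pred ℕ 0ℓ} → Decidable P → ∃ P →
          ∀ n → (∀ {j} → P j → j ≤ n) → ∃ (IsMaximum P)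
maximum P? i n bound with P? n
... | yes pn = n , pn , bound
maximum P? (i , pi) zero bound | no ¬pn with z≤n ← bound pi = ⊥-elim (¬pn pi)
maximum {P} P? i (suc n) bound | no ¬pn = maximum P? i n bound′
  where
  bound′ : ∀ {j} → P j → j ≤ n
  bound′ pj with m≤n⇒m<n∨m≡n (bound pj)
  ... | inj₁ (s≤s j≤n) = j≤n
  ... | inj₂ refl      = ⊥-elim (¬pn pj)

-- Walks all of whose interior vertices lie in a given list (Warshall).
module _ {n} {R : Rel (Fin n) 0ℓ} (R? : Decidable₂ R) where

  Reach : List (Fin n) → Rel (Fin n) 0ℓ
  Reach []      u v = u ≡ v ⊎ R u v
  Reach (x ∷ L) u v = Reach L u v ⊎ (Reach L u x × Reach L x v)

  reach? : ∀ L → Decidable₂ (Reach L)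
  reach? []      u v = (u ≟ v) ⊎-dec R? u v
  reach? (x ∷ L) u v = reach? L u v ⊎-dec (reach? L u x ×-dec reach? L x v)

  reach-sound : ∀ L {u v} → Reach L u v → Star R u v
  reach-sound []      (inj₁ refl)    = ε
  reach-sound []      (inj₂ r)       = r ◅ ε
  reach-sound (x ∷ L) (inj₁ p)       = reach-sound L p
  reach-sound (x ∷ L) (inj₂ (p , q)) = reach-sound L p ◅◅ reach-sound L q

  reach-base : ∀ L {u v} → u ≡ v ⊎ R u v → Reach L u v
  reach-base []      p = p
  reach-base (x ∷ L) p = inj₁ (reach-base L p)

  reach-trans : ∀ L {u x v} → x ∈ₗ L → Reach L u x → Reach L x v → Reach L u v
  reach-trans (_ ∷ L) (here refl) p q = inj₂ ([ (λ r → r) , proj₁ ]′ p , [ (λ r → r) , proj₂ ]′ q)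
  reach-trans (_ ∷ L) (there i) (inj₁ p)       (inj₁ q)       = inj₁ (reach-trans L i p q)
  reach-trans (_ ∷ L) (there i) (inj₁ p)       (inj₂ (q , r)) = inj₂ (reach-trans L i p q , r)
  reach-trans (_ ∷ L) (there i) (inj₂ (p , q)) (inj₁ r)       = inj₂ (p , reach-trans L i q r)
  reach-trans (_ ∷ L) (there i) (inj₂ (p , _)) (inj₂ (_ , s)) = inj₂ (p , s)

  reach-complete : ∀ {u v} → Star R u v → Reach (allFin n) u v
  reach-complete ε        = reach-base (allFin n) (inj₁ refl)
  reach-complete (r ◅ rs) =
    reach-trans (allFin n) (∈-allFin _) (reach-base (allFin n) (inj₂ r)) (reach-complete rs)

  star? : Decidable₂ (Star R)
  star? u v = map′ (reach-sound (allFin n)) reach-complete (reach? (allFin n) u v)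

all∈? : ∀ {A : Set} {P : Pred A 0ℓ} → Decidable P → ∀ xs → Dec (∀ {x} → x ∈ₗ xs → P x)
all∈? P? xs = map′ (λ ps {x} → All.lookup ps) (λ f → All.tabulate f) (All.all? P? xs)

module _ {n} (G : Graph n) where

  inducedAdj? : ∀ A → Decidable₂ (InducedAdj G A)
  inducedAdj? A u v = (u ∈? A) ×-dec ((v ∈? A) ×-dec Graph.adj? G u v)

  connected? : Decidable (Connected G)
  connected? A = map′ (λ f {u} {v} → f u v) (λ f u v → f {u} {v})
    (all? λ u → all? λ v → (u ∈? A) →-dec ((v ∈? A) →-dec star? (inducedAdj? A) u v))

  strictBramble? : Decidable (StrictBramble G)
  strictBramble? S = map′ to from
    (all∈? nonempty? S
      ×-dec (all∈? connected? S
      ×-dec all∈? (λ A → all∈? (λ B → nonempty? (A ∩ B)) S) S))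
    where
    Conditions : Set
    Conditions = (∀ {A} → A ∈ₗ S → Nonempty A)
               × (∀ {A} → A ∈ₗ S → Connected G A)
               × (∀ {A} → A ∈ₗ S → ∀ {B} → B ∈ₗ S → Nonempty (A ∩ B))

    to : Conditions → StrictBramble G S
    to (f , g , h) = record
      { nonempty = f ; connected = λ i → g i ; intersect = λ i j → h i j }

    from : StrictBramble G S → Conditions
    from b = nonempty , (λ i → connected i) , (λ i j → intersect i j)
      where open StrictBramble b

hittingSize? : ∀ {n} (S : Collection n) → Decidable (HittingSize S)
hittingSize? S k =
  anySubset? λ X → all∈? (λ A → nonempty? (A ∩ X)) S ×-dec (∣ X ∣ ≟ⁿ k)

orderExists : ∀ {n} {G : Graph n} {S} → StrictBramble G S → ∃ (IsOrder S)
orderExists {n} {S = S} b =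
  minimum (hittingSize? S) n (⊤ , (λ i → let x , x∈A = nonempty i in x , x∈p∩q⁺ (x∈A , ∈⊤)) , ∣⊤∣≡n n)
  where open StrictBramble b

strictBrambleOfOrder? : ∀ {n} (G : Graph n) k →
                        Decidable λ S → StrictBramble G S × IsOrder S k
strictBrambleOfOrder? G k S with strictBramble? G S
... | no ¬b = no (¬b ∘ proj₁)
... | yes b with orderExists b
...   | m , pm , least =
  map′ (λ { refl → b , pm , least })
       (λ (_ , pk , leastₖ) → ≤-antisym (least pk) (leastₖ pm))
       (m ≟ⁿ k)

_≟ˢ_ : ∀ {n} → DecidableEquality (Subset n)
_≟ˢ_ = ≡-dec _≟ᵇ_

allSubsets : ∀ n → Collection n
allSubsets zero    = [] ∷ []
allSubsets (suc n) = map (inside ∷_) (allSubsets n) ++ map (outside ∷_) (allSubsets n)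

∈-allSubsets : ∀ {n} (A : Subset n) → A ∈ₗ allSubsets n
∈-allSubsets []            = here refl
∈-allSubsets (inside  ∷ A) = ∈-++⁺ˡ (∈-map⁺ (inside ∷_) (∈-allSubsets A))
∈-allSubsets (outside ∷ A) =
  ∈-++⁺ʳ (map (inside ∷_) (allSubsets _)) (∈-map⁺ (outside ∷_) (∈-allSubsets A))

subcollections : ∀ {n} → Collection n → List (Collection n)
subcollections []      = [] ∷ []
subcollections (A ∷ S) = map (A ∷_) (subcollections S) ++ subcollections S

filter∈subcollections : ∀ {n} {P : Pred (Subset n) 0ℓ} (P? : Decidable P) S →
                        filter P? S ∈ₗ subcollections S
filter∈subcollections P? []      = here refl
filter∈subcollections P? (A ∷ S) with P? A
... | yes _ = ∈-++⁺ˡ (∈-map⁺ (A ∷_) (filter∈subcollections P? S))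
... | no  _ = ∈-++⁺ʳ (map (A ∷_) (subcollections S)) (filter∈subcollections P? S)

infix 4 _≈_
_≈_ : ∀ {n} → Rel (Collection n) 0ℓ
S ≈ T = (∀ {A} → A ∈ₗ S → A ∈ₗ T) × (∀ {A} → A ∈ₗ T → A ∈ₗ S)

strictBrambleOfOrder-resp : ∀ {n} {G : Graph n} {k} {S T : Collection n} → S ≈ T →
  StrictBramble G S × IsOrder S k → StrictBramble G T × IsOrder T k
strictBrambleOfOrder-resp (to , from) (b , (X , hit , eq) , least) =
  record
    { nonempty  = λ i → nonempty (from i)
    ; connected = λ i → connected (from i)
    ; intersect = λ i j → intersect (from i) (from j)
    }
  , (X , (λ i → hit (from i)) , eq)
  , λ (Y , hitY , eqY) → least (Y , (λ i → hitY (to i)) , eqY)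
  where open StrictBramble b

anyCollection? : ∀ {n} {P : Pred (Collection n) 0ℓ} → Decidable P →
                 (∀ {S T} → S ≈ T → P S → P T) → Dec (∃ P)
anyCollection? {n} P? resp = map′
  (λ i → let S , _ , p = find i in S , p)
  (λ (S , p) → let _∈S? = λ A → DecMembership._∈?_ _≟ˢ_ A S in
    lose (filter∈subcollections _∈S? (allSubsets n))
         (resp ( (λ {A} i → ∈-filter⁺ _∈S? (∈-allSubsets A) i)
               , (λ {A} i → proj₂ (∈-filter⁻ _∈S? {xs = allSubsets n} i))) p))
  (Any.any? P? (subcollections (allSubsets n)))

sbnExists : ∀ {n} (G : Graph n) → ∃ (IsSbn G)
sbnExists {n} G = maximum
  (λ k → anyCollection? (strictBrambleOfOrder? G k) strictBrambleOfOrder-resp)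
  (let k , ord = orderExists empty in k , [] , empty , ord)
  n
  (λ { (_ , _ , (X , _ , refl) , _) → ∣p∣≤n X })
  where
  empty : StrictBramble G []
  empty = record { nonempty = λ () ; connected = λ () ; intersect = λ () }

sbn : ∀ {n} → Graph n → ℕ
sbn G = proj₁ (sbnExists G)

sbn-isSbn : ∀ {n} (G : Graph n) → IsSbn G (sbn G)
sbn-isSbn G = proj₂ (sbnExists G)

{-# OPTIONS --safe #-}
-- For strict brambles S of G and T of H of maximum order a and b, consider the
-- sets ⋃_{g ∈ A} {g} × f(g) with A ∈ S and f : A → T.  Members of T intersect
-- pairwise, so walks in G[A] lift, which gives connectedness; intersecting in
-- both coordinates gives pairwise intersection.  If X hits all these sets, the
-- g whose fibre X_g has at least b elements form a hitting set for S: otherwise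
-- some A ∈ S avoids them, and each g ∈ A admits f(g) ∈ T disjoint from X_g, so
-- X misses the resulting set.  Hence at least a fibres have at least b elements.
module Submission where

open import Defs
open import Data.Bool.Properties using (T-≡)
open import Data.Empty using (⊥-elim)
open import Data.Fin using (Fin; combine)
open import Data.Fin.Properties using (all?; combine-surjective; remQuot-combine)
open import Data.Fin.Subset using (Subset; inside; outside; _∈_; _∩_; ∣_∣; Nonempty; Empty; ⊥)
open import Data.Fin.Subset.Properties using (_∈?_; nonempty?; ∉⊥; x∈p∩q⁺; x∈p∩q⁻)
open import Data.List using (filter)
open import Data.List.Membership.Propositional using (find; lose) renaming (_∈_ to _∈ₗ_)
open import Data.List.Membership.Propositional.Properties using (∈-filter⁺; ∈-filter⁻)
import Data.List.Membership.DecPropositional as DecMembership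
import Data.List.Relation.Unary.All as All
open import Data.List.Relation.Unary.All.Properties using (¬All⇒Any¬)
open import Data.List.Relation.Unary.Any as Any using (Any)
open import Data.Nat using (ℕ; suc; _+_; _*_; _≤_; _≥_; _≤ᵇ_)
open import Data.Nat.Properties
  using (≤-trans; ≤-reflexive; ≤ᵇ⇒≤; ≤⇒≤ᵇ; +-mono-≤; m≤n⇒m≤o+n; *-suc; *-comm; *-zeroʳ; *-monoʳ-≤)
open import Data.Product using (∃; _×_; _,_; proj₁; proj₂)
open import Data.Sum using (inj₁; inj₂)
open import Data.Vec using (Vec; []; _∷_; _++_; concat; group; lookup; map; tabulate)
open import Data.Vec.Properties
  using (lookup-concat; lookup∘tabulate; tabulate∘lookup; tabulate-cong; lookup-map; []=⇒lookup; lookup⇒[]=)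
open import Function using (_∘_)
open import Function.Bundles using (Equivalence)
open import Relation.Binary.Construct.Closure.ReflexiveTransitive using (Star; ε; _◅_; _◅◅_; gmap)
open import Relation.Binary.PropositionalEquality using (_≡_; refl; sym; trans; cong; subst; subst₂)
open import Relation.Nullary using (¬_; yes; no)
open import Relation.Nullary.Decidable using (_×-dec_; _→-dec_; decidable-stable)
open import Relation.Unary using (Decidable)

-- `S` is a finite list and meeting `X` is decidable, so a failure to hit yields an actual missed
-- member.
¬HittingSet⇒missed : ∀ {n} {S : Collection n} {X} → ¬ HittingSet S X → ∃ λ A → A ∈ₗ S × Empty (A ∩ X)
¬HittingSet⇒missed {S = S} {X} ¬hit =
  find (¬All⇒Any¬ (λ A → nonempty? (A ∩ X)) S (λ hits → ¬hit (All.lookup hits)))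

order≤∣hittingSet∣ : ∀ {n} {S : Collection n} {k X} → IsOrder S k → HittingSet S X → k ≤ ∣ X ∣
order≤∣hittingSet∣ (_ , least) hit = least (_ , hit , refl)

order≤sbn : ∀ {n} {G : Graph n} {S k} → StrictBramble G S → IsOrder S k → k ≤ sbn G
order≤sbn {G = G} b ord = proj₂ (sbn-isSbn G) (_ , b , ord)

∣++∣ : ∀ {m n} (p : Subset m) (q : Subset n) → ∣ p ++ q ∣ ≡ ∣ p ∣ + ∣ q ∣
∣++∣ []            q = refl
∣++∣ (inside  ∷ p) q = cong suc (∣++∣ p q)
∣++∣ (outside ∷ p) q = ∣++∣ p q

heavy : ∀ {m n} → ℕ → Vec (Subset n) m → Subset m
heavy b = map (λ p → b ≤ᵇ ∣ p ∣)

∈-heavy : ∀ {m n b} (ps : Vec (Subset n) m) {i} → b ≤ ∣ lookup ps i ∣ → i ∈ heavy b ps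
∈-heavy {b = b} ps {i} b≤ =
  lookup⇒[]= i (heavy b ps) (trans (lookup-map i _ ps) (Equivalence.to T-≡ (≤⇒≤ᵇ b≤)))

-- Each heavy row contributes at least `b` elements to the concatenation, and the other rows are
-- discarded from the count.
*∣heavy∣≤∣concat∣ : ∀ {m n} b (ps : Vec (Subset n) m) → b * ∣ heavy b ps ∣ ≤ ∣ concat ps ∣
*∣heavy∣≤∣concat∣ b []       = ≤-reflexive (*-zeroʳ b)
*∣heavy∣≤∣concat∣ b (p ∷ ps) rewrite ∣++∣ p (concat ps) with b ≤ᵇ ∣ p ∣ in eq
... | inside rewrite *-suc b ∣ heavy b ps ∣ =
  +-mono-≤ (≤ᵇ⇒≤ b _ (Equivalence.from T-≡ eq)) (*∣heavy∣≤∣concat∣ b ps)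
... | outside = m≤n⇒m≤o+n ∣ p ∣ (*∣heavy∣≤∣concat∣ b ps)

fibre : ∀ {m n} → Subset (m * n) → Fin m → Subset n
fibre Z g = tabulate (λ h → lookup Z (combine g h))

∈-fibre⁺ : ∀ {m n} {Z : Subset (m * n)} {g h} → combine g h ∈ Z → h ∈ fibre {m} Z g
∈-fibre⁺ {h = h} i = lookup⇒[]= h _ (trans (lookup∘tabulate _ h) ([]=⇒lookup i))

∈-fibre⁻ : ∀ {m n} {Z : Subset (m * n)} {g h} → h ∈ fibre {m} Z g → combine g h ∈ Z
∈-fibre⁻ {Z = Z} {h = h} i = lookup⇒[]= _ Z (trans (sym (lookup∘tabulate _ h)) ([]=⇒lookup i))

-- `combine` numbers pairs row by row, the order in which `concat` lays out its rows.
fibre-concat : ∀ {m n} (ps : Vec (Subset n) m) g → fibre (concat ps) g ≡ lookup ps g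
fibre-concat ps g = trans (tabulate-cong (lookup-concat ps g)) (tabulate∘lookup (lookup ps g))

module _ {m n} (S : Collection m) (T : Collection n) where

  -- Encodes ⋃_{g ∈ A} {g} × f(g) without naming f: f(g) can only be the fibre of `Z` at `g`, and
  -- the second conjunct empties the fibres outside `A`.
  IsUnionOver : Subset (m * n) → Subset m → Set
  IsUnionOver Z A = ∀ g → (g ∈ A → fibre Z g ∈ₗ T) × (Nonempty (fibre Z g) → g ∈ A)

  isUnion? : Decidable (λ Z → Any (IsUnionOver Z) S)
  isUnion? Z = Any.any? (λ A → all? λ g →
    ((g ∈? A) →-dec DecMembership._∈?_ _≟ˢ_ (fibre Z g) T)
      ×-dec (nonempty? (fibre Z g) →-dec (g ∈? A))) S

  -- Filtering by a decidable property replaces an enumeration of the functions from `A` to `T`.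
  unions : Collection (m * n)
  unions = filter isUnion? (allSubsets (m * n))

  ∈-unions⁺ : ∀ {Z A} → A ∈ₗ S → IsUnionOver Z A → Z ∈ₗ unions
  ∈-unions⁺ {Z} A∈S u = ∈-filter⁺ isUnion? (∈-allSubsets Z) (lose A∈S u)

  ∈-unions⁻ : ∀ {Z} → Z ∈ₗ unions → ∃ λ A → A ∈ₗ S × IsUnionOver Z A
  ∈-unions⁻ Z∈ = find (proj₂ (∈-filter⁻ isUnion? {xs = allSubsets (m * n)} Z∈))

module _ {m n} (G : Graph m) (H : Graph n) where

  □-adjʳ : ∀ {g : Fin m} {h h′ : Fin n} → Graph.Adj H h h′ →
           Graph.Adj (G □ H) (combine g h) (combine g h′)
  □-adjʳ {g} {h} {h′} e = inj₁
    ( trans (cong proj₁ (remQuot-combine g h)) (sym (cong proj₁ (remQuot-combine g h′)))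
    , subst₂ (Graph.Adj H) (sym (cong proj₂ (remQuot-combine g h)))
                           (sym (cong proj₂ (remQuot-combine g h′))) e )

  □-adjˡ : ∀ {g g′ : Fin m} {h : Fin n} → Graph.Adj G g g′ →
           Graph.Adj (G □ H) (combine g h) (combine g′ h)
  □-adjˡ {g} {g′} {h} e = inj₂
    ( subst₂ (Graph.Adj G) (sym (cong proj₁ (remQuot-combine g h)))
                           (sym (cong proj₁ (remQuot-combine g′ h))) e
    , trans (cong proj₂ (remQuot-combine g h)) (sym (cong proj₂ (remQuot-combine g′ h))) )

module _ {m n} {G : Graph m} {H : Graph n} {S : Collection m} {T : Collection n}
         (bS : StrictBramble G S) (bT : StrictBramble H T) where

  private
    module S = StrictBramble bS
    module T = StrictBramble bT

  module _ {Z A} (over : IsUnionOver S T Z A) where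

    -- A fibre over `A` is a member of `T`, hence connected in `H`, and `combine g` carries its
    -- walks into `Z`.
    fibreWalk : ∀ {g h h′} → g ∈ A → h ∈ fibre Z g → h′ ∈ fibre Z g →
                Star (InducedAdj (G □ H) Z) (combine g h) (combine g h′)
    fibreWalk {g} g∈A h∈ h′∈ = gmap (combine g)
      (λ (i , j , e) → ∈-fibre⁻ {m} i , ∈-fibre⁻ {m} j , □-adjʳ G H e)
      (T.connected (proj₁ (over g) g∈A) h∈ h′∈)

    -- Induction on the walk in `G[A]`. The fibres at both ends of an edge share a vertex `p`: walk
    -- to `p` in the first fibre, then cross to the copy of `p` in the second.
    liftWalk : ∀ {g g′ h h′} → Star (InducedAdj G A) g g′ → g ∈ A →
               h ∈ fibre Z g → h′ ∈ fibre Z g′ →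
               Star (InducedAdj (G □ H) Z) (combine g h) (combine g′ h′)
    liftWalk ε g∈A h∈ h′∈ = fibreWalk g∈A h∈ h′∈
    liftWalk {g} (_◅_ {j = k} (_ , k∈A , e) w) g∈A h∈ h′∈ =
      let p , p∈       = T.intersect (proj₁ (over g) g∈A) (proj₁ (over k) k∈A)
          p∈Zg , p∈Zk = x∈p∩q⁻ (fibre Z g) (fibre Z k) p∈
      in fibreWalk g∈A h∈ p∈Zg
           ◅◅ (∈-fibre⁻ {m} p∈Zg , ∈-fibre⁻ {m} p∈Zk , □-adjˡ G H e)
           ◅ liftWalk w k∈A p∈Zk h′∈

    union-connected : A ∈ₗ S → Connected (G □ H) Z
    union-connected A∈S {u} {v} u∈ v∈
      with g  , h  , refl ← combine-surjective {m} {n} u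
         | g′ , h′ , refl ← combine-surjective {m} {n} v =
      let h∈   = ∈-fibre⁺ {m} u∈
          h′∈  = ∈-fibre⁺ {m} v∈
          g∈A  = proj₂ (over g) (h , h∈)
          g′∈A = proj₂ (over g′) (h′ , h′∈)
      in liftWalk (S.connected A∈S g∈A g′∈A) g∈A h∈ h′∈

  unions-strictBramble : StrictBramble (G □ H) (unions S T)
  unions-strictBramble = record
    { nonempty  = λ Z∈ →
        let A , A∈S , over = ∈-unions⁻ S T Z∈
            g , g∈A        = S.nonempty A∈S
            h , h∈         = T.nonempty (proj₁ (over g) g∈A)
        in combine g h , ∈-fibre⁻ {m} h∈
    ; connected = λ Z∈ → let _ , A∈S , over = ∈-unions⁻ S T Z∈ in union-connected over A∈S
    ; intersect = λ {Z} {Z′} Z∈ Z′∈ →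
        let A  , A∈S  , over  = ∈-unions⁻ S T Z∈
            A′ , A′∈S , over′ = ∈-unions⁻ S T Z′∈
            g , g∈            = S.intersect A∈S A′∈S
            g∈A , g∈A′        = x∈p∩q⁻ A A′ g∈
            -- Both fibres over the common vertex `g` are members of `T`, so they meet.
            h , h∈            = T.intersect (proj₁ (over g) g∈A) (proj₁ (over′ g) g∈A′)
            h∈Z , h∈Z′        = x∈p∩q⁻ (fibre Z g) (fibre Z′ g) h∈
        in combine g h , x∈p∩q⁺ (∈-fibre⁻ {m} h∈Z , ∈-fibre⁻ {m} h∈Z′)
    }

module _ {m n} {S : Collection m} {T : Collection n} {b} (ordT : IsOrder T b) where

  hitting⇒heavy-hitting : ∀ (ps : Vec (Subset n) m) →
    HittingSet (unions S T) (concat ps) → HittingSet S (heavy b ps)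
  hitting⇒heavy-hitting ps hit {A} A∈S =
    -- Nonemptiness is decidable, so it suffices to refute that `A` avoids every heavy row.
    decidable-stable (nonempty? (A ∩ heavy b ps)) λ light →
      let pick = choose light
          f = proj₁ ∘ pick
          Z = concat (tabulate f)
          fibre≡ : ∀ g → fibre Z g ≡ f g
          fibre≡ g = trans (fibre-concat (tabulate f) g) (lookup∘tabulate f g)
          over : IsUnionOver S T Z A
          over g = (λ g∈A → subst (_∈ₗ T) (sym (fibre≡ g)) (proj₁ (proj₁ (proj₂ (pick g)) g∈A)))
                 , (λ ne → proj₂ (proj₂ (pick g)) (subst Nonempty (fibre≡ g) ne))
          x , x∈         = hit (∈-unions⁺ S T A∈S over)
          x∈Z , x∈X      = x∈p∩q⁻ Z (concat ps) x∈
          g , h , eq     = combine-surjective {m} {n} x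
          h∈f = subst (h ∈_) (fibre≡ g) (∈-fibre⁺ {m} (subst (_∈ Z) (sym eq) x∈Z))
          h∈p = subst (h ∈_) (fibre-concat ps g) (∈-fibre⁺ {m} (subst (_∈ concat ps) (sym eq) x∈X))
          g∈A = proj₂ (proj₂ (pick g)) (h , h∈f)
      -- The hit vertex puts `h` both in `f g` and in row `g`, which were chosen disjoint.
      in proj₂ (proj₁ (proj₂ (pick g)) g∈A) (h , x∈p∩q⁺ (h∈f , h∈p))
    where
    choose : Empty (A ∩ heavy b ps) → ∀ g →
             ∃ λ B → (g ∈ A → B ∈ₗ T × Empty (B ∩ lookup ps g)) × (Nonempty B → g ∈ A)
    choose light g with g ∈? A
    -- Outside `A` the empty set is chosen, so the union has no vertex over `g`.
    ... | no  g∉A = ⊥ , (λ g∈A → ⊥-elim (g∉A g∈A)) , λ (_ , h∈⊥) → ⊥-elim (∉⊥ h∈⊥)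
    ... | yes g∈A =
      -- If row `g` hit all of `T`, it would have at least `b` elements, making `g` a heavy vertex
      -- of `A`.
      let B , B∈T , miss = ¬HittingSet⇒missed {X = lookup ps g} λ hitT →
            light (g , x∈p∩q⁺ (g∈A , ∈-heavy ps (order≤∣hittingSet∣ ordT hitT)))
      in B , (λ _ → B∈T , miss) , λ _ → g∈A

  order-product≤ : ∀ {a k} → IsOrder S a → IsOrder (unions S T) k → a * b ≤ k
  -- Cutting the hitting set `X` into `m` rows of length `n` exposes its fibres.
  order-product≤ {a} ordS ((X , hit , refl) , _) with ps , refl ← group m n X =
    ≤-trans (≤-reflexive (*-comm a b))
      (≤-trans (*-monoʳ-≤ b (order≤∣hittingSet∣ ordS (hitting⇒heavy-hitting ps hit)))
               (*∣heavy∣≤∣concat∣ b ps))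

theorem8 : ∀ {m n : ℕ} (G : Graph m) (H : Graph n) → sbn (G □ H) ≥ sbn G * sbn H
theorem8 G H =
  -- `S` and `T` attain the two strict bramble numbers as their orders.
  let (S , bS , ordS) , _ = sbn-isSbn G
      (T , bT , ordT) , _ = sbn-isSbn H
      bU       = unions-strictBramble bS bT
      k , ordU = orderExists bU
  in ≤-trans (order-product≤ ordT ordS ordU) (order≤sbn bU ordU)
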